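{- Let $(G,s,t)$ be an oriented serial superedge whose principal subgraphs are $(G_1,s_1,t_1),\dots,(G_k,s_k,t_k)$, where $s=s_1$, $t_i=s_{i+1}$ for $1\le i\le k$, and $s_{k+1}=t$, and suppose each $G_i$ is non-serial. Then $\mathrm{Aut}_{\mathrm{or}}(G,s,t)\cong\prod_{i=1}^k\mathrm{Aut}_{\mathrm{or}}(G_i,s_i,t_i)$.
   Context: All graphs are finite, simple and undirected. An oriented series-parallel graph is a triple $(G,s,t)$ where $G$ is a graph and $s\neq t$ are vertices, defined recursively: (i) $G$ is a single edge with vertex set $\{s,t\}$; or (ii) (serial superedge) there are $k\ge 2$ oriented series-parallel graphs $(G_1,s_1,t_1),\dots,(G_k,s_k,t_k)$ with $s_1=s$, $t_k=t$, $t_i=s_{i+1}$ for $1\le i<k$, $V(G_i)\cap V(G_{i+1})=\{s_{i+1}\}$, $V(G_i)\cap V(G_j)=\emptyset$ for $|i-j|\ge2$, and $G=G_1\cup\dots\cup G_k$; or (iii) (parallel superedge) there are $k\ge2$ oriented series-parallel graphs $(G_1,s,t),\dots,(G_k,s,t)$ with $V(G_i)\cap V(G_j)=\{s,t\}$ for $i\neq j$ and $G=G_1\cup\dots\cup G_k$. The $G_i$ are the principal subgraphs. A graph is non-serial if it is not a serial superedge. For an oriented series-parallel graph $(H,u,v)$, $\mathrm{Aut}_{\mathrm{or}}(H,u,v)$ is the group of automorphisms of $H$ fixing both $u$ and $v$. -}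

module Defs where

open import Algebra.Bundles using (Group)
open import Algebra.Morphism.Structures using (module GroupMorphisms)
open import Data.Bool.Base using (Bool; T)
open import Data.Fin.Base using (Fin; toℕ)
open import Data.Fin.Subset using (Subset; _∈_; _∪_; _∩_; ⁅_⁆; ⊥)
open import Data.Nat.Base using (ℕ; suc; _≤_; ∣_-_∣)
open import Data.Product.Base using (Σ; ∃; ∃-syntax; _×_; _,_; proj₁)
open import Function.Base using (_∘_)
open import Function.Bundles using (_⇔_; _↔_; Inverse; Equivalence; mk⇔)
open import Function.Construct.Composition using (_⇔-∘_; _↔-∘_)
open import Function.Construct.Identity using (⇔-id; ↔-id)
open import Function.Construct.Symmetry using (⇔-sym; ↔-sym)
open import Level using (Level; 0ℓ; _⊔_)
open import Relation.Binary.PropositionalEquality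
  using (_≡_; _≢_; refl; sym; trans; cong; subst₂)
open import Relation.Nullary using (¬_)

private
  variable
    n k : ℕ
    a c ℓ c′ ℓ′ : Level

-- Vertices are drawn from an ambient finite set Fin n, of which the vertex
-- set is an arbitrary subset, so that unions and intersections of graphs are
-- literal ones.
record Graph (n : ℕ) : Set where
  field
    vertices : Subset n
    adj      : Fin n → Fin n → Bool

  Adj : Fin n → Fin n → Set
  Adj u v = T (adj u v)

  field
    adj-vertex : ∀ {u v} → Adj u v → u ∈ vertices
    adj-sym    : ∀ {u v} → Adj u v → Adj v u
    adj-irrefl : ∀ {u} → ¬ Adj u u

  Vertex : Set
  Vertex = Σ (Fin n) (_∈ vertices)

record OrientedGraph (n : ℕ) : Set where
  field
    graph : Graph n

  open Graph graph public

  field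
    source        : Fin n
    target        : Fin n
    source∈       : source ∈ vertices
    target∈       : target ∈ vertices
    source≢target : source ≢ target

  sourceVertex : Vertex
  sourceVertex = source , source∈

  targetVertex : Vertex
  targetVertex = target , target∈

open OrientedGraph

record IsUnion (G : Graph n) (Gs : Fin k → Graph n) : Set where
  field
    vertices-⋃ : ∀ v → v ∈ Graph.vertices G ⇔ (∃[ i ] v ∈ Graph.vertices (Gs i))
    edges-⋃    : ∀ u v → Graph.Adj G u v ⇔ (∃[ i ] Graph.Adj (Gs i) u v)

record IsSingleEdge (G : OrientedGraph n) : Set where
  field
    vertices-≡ : vertices G ≡ ⁅ source G ⁆ ∪ ⁅ target G ⁆
    adjacent   : Adj G (source G) (target G)

-- The index i : Fin k stands for the (1 + toℕ i)-th part.
record IsSerialComposition (G : OrientedGraph n)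
                           (Gs : Fin k → OrientedGraph n) : Set where
  field
    2≤k     : 2 ≤ k
    first   : ∀ i → toℕ i ≡ 0 → source (Gs i) ≡ source G
    last    : ∀ i → suc (toℕ i) ≡ k → target (Gs i) ≡ target G
    link    : ∀ i j → toℕ j ≡ suc (toℕ i) → target (Gs i) ≡ source (Gs j)
    meet    : ∀ i j → toℕ j ≡ suc (toℕ i) →
              vertices (Gs i) ∩ vertices (Gs j) ≡ ⁅ source (Gs j) ⁆
    far     : ∀ i j → 2 ≤ ∣ toℕ i - toℕ j ∣ →
              vertices (Gs i) ∩ vertices (Gs j) ≡ ⊥
    isUnion : IsUnion (graph G) (graph ∘ Gs)

record IsParallelComposition (G : OrientedGraph n)
                             (Gs : Fin k → OrientedGraph n) : Set where
  field
    2≤k     : 2 ≤ k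
    sources : ∀ i → source (Gs i) ≡ source G
    targets : ∀ i → target (Gs i) ≡ target G
    meet    : ∀ i j → i ≢ j →
              vertices (Gs i) ∩ vertices (Gs j) ≡ ⁅ source G ⁆ ∪ ⁅ target G ⁆
    isUnion : IsUnion (graph G) (graph ∘ Gs)

data IsSeriesParallel {n : ℕ} : OrientedGraph n → Set where
  edge     : ∀ {G} → IsSingleEdge G → IsSeriesParallel G
  serial   : ∀ {k G} {Gs : Fin k → OrientedGraph n} →
             IsSerialComposition G Gs →
             (∀ i → IsSeriesParallel (Gs i)) → IsSeriesParallel G
  parallel : ∀ {k G} {Gs : Fin k → OrientedGraph n} →
             IsParallelComposition G Gs →
             (∀ i → IsSeriesParallel (Gs i)) → IsSeriesParallel G

IsSerialSuperedge : OrientedGraph n → (Fin k → OrientedGraph n) → Set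
IsSerialSuperedge G Gs =
  IsSerialComposition G Gs × (∀ i → IsSeriesParallel (Gs i))

NonSerial : OrientedGraph n → Set
NonSerial {n} G =
  ¬ (∃[ k ] Σ (Fin k → OrientedGraph n) λ Gs → IsSerialSuperedge G Gs)

-- Equality on Vertex is equality of the underlying elements of Fin n, since
-- membership in a Subset is proof-irrelevant.
record OrientedAutomorphism (H : OrientedGraph n) : Set where
  field
    bijection : Vertex H ↔ Vertex H

  open Inverse bijection public using (to; from; strictlyInverseˡ; strictlyInverseʳ)

  field
    preserves-adj : ∀ x y →
      Adj H (proj₁ x) (proj₁ y) ⇔ Adj H (proj₁ (to x)) (proj₁ (to y))
    fixes-source  : to (sourceVertex H) ≡ sourceVertex H
    fixes-target  : to (targetVertex H) ≡ targetVertex H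

module _ (H : OrientedGraph n) where
  open OrientedAutomorphism

  private
    _∙_ : OrientedAutomorphism H → OrientedAutomorphism H → OrientedAutomorphism H
    f ∙ g = record
      { bijection     = bijection f ↔-∘ bijection g
      ; preserves-adj = λ x y →
          preserves-adj f (to g x) (to g y) ⇔-∘ preserves-adj g x y
      ; fixes-source  = trans (cong (to f) (fixes-source g)) (fixes-source f)
      ; fixes-target  = trans (cong (to f) (fixes-target g)) (fixes-target f)
      }

    identity : OrientedAutomorphism H
    identity = record
      { bijection     = ↔-id _
      ; preserves-adj = λ _ _ → ⇔-id _
      ; fixes-source  = refl
      ; fixes-target  = refl
      }

    from-fixes : ∀ (f : OrientedAutomorphism H) {x} → to f x ≡ x → from f x ≡ x
    from-fixes f {x} fx≡x =
      trans (cong (from f) (sym fx≡x)) (strictlyInverseʳ f x)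

    _⁻¹ : OrientedAutomorphism H → OrientedAutomorphism H
    f ⁻¹ = record
      { bijection     = ↔-sym (bijection f)
      ; preserves-adj = λ x y → mk⇔
          (λ xy → Equivalence.from (preserves-adj f (from f x) (from f y))
                    (subst₂ (λ u v → Adj H (proj₁ u) (proj₁ v))
                      (sym (strictlyInverseˡ f x)) (sym (strictlyInverseˡ f y)) xy))
          (λ xy → subst₂ (λ u v → Adj H (proj₁ u) (proj₁ v))
                    (strictlyInverseˡ f x) (strictlyInverseˡ f y)
                    (Equivalence.to (preserves-adj f (from f x) (from f y)) xy))
      ; fixes-source  = from-fixes f (fixes-source f)
      ; fixes-target  = from-fixes f (fixes-target f)
      }

  Autₒᵣ : Group 0ℓ 0ℓ
  Autₒᵣ = record
    { Carrier = OrientedAutomorphism H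
    ; _≈_     = λ f g → ∀ x → to f x ≡ to g x
    ; _∙_     = _∙_
    ; ε       = identity
    ; _⁻¹     = _⁻¹
    ; isGroup = record
      { isMonoid = record
        { isSemigroup = record
          { isMagma = record
            { isEquivalence = record
              { refl  = λ _ → refl
              ; sym   = λ f≈g x → sym (f≈g x)
              ; trans = λ f≈g g≈h x → trans (f≈g x) (g≈h x)
              }
            ; ∙-cong = λ {f} {f′} {g} {g′} f≈f′ g≈g′ x →
                trans (cong (to f) (g≈g′ x)) (f≈f′ (to g′ x))
            }
          ; assoc = λ _ _ _ _ → refl
          }
        ; identity = (λ _ _ → refl) , (λ _ _ → refl)
        }
      ; inverse = strictlyInverseʳ , strictlyInverseˡ
      ; ⁻¹-cong = λ {f} {g} f≈g x →
          trans (cong (from f)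
                  (trans (sym (strictlyInverseˡ g x)) (sym (f≈g (from g x)))))
                (strictlyInverseʳ f (from g x))
      }
    }

∏ : {I : Set a} → (I → Group c ℓ) → Group (a ⊔ c) (a ⊔ ℓ)
∏ {I = I} F = record
  { Carrier = ∀ i → F.Carrier i
  ; _≈_     = λ x y → ∀ i → F._≈_ i (x i) (y i)
  ; _∙_     = λ x y i → F._∙_ i (x i) (y i)
  ; ε       = λ i → F.ε i
  ; _⁻¹     = λ x i → F._⁻¹ i (x i)
  ; isGroup = record
    { isMonoid = record
      { isSemigroup = record
        { isMagma = record
          { isEquivalence = record
            { refl  = λ i → F.refl i
            ; sym   = λ p i → F.sym i (p i)
            ; trans = λ p q i → F.trans i (p i) (q i)
            }
          ; ∙-cong = λ p q i → F.∙-cong i (p i) (q i)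
          }
        ; assoc = λ x y z i → F.assoc i (x i) (y i) (z i)
        }
      ; identity = (λ x i → F.identityˡ i (x i)) , (λ x i → F.identityʳ i (x i))
      }
    ; inverse = (λ x i → F.inverseˡ i (x i)) , (λ x i → F.inverseʳ i (x i))
    ; ⁻¹-cong = λ p i → F.⁻¹-cong i (p i)
    }
  }
  where module F i = Group (F i)

infix 4 _≅_

_≅_ : Group c ℓ → Group c′ ℓ′ → Set (c ⊔ ℓ ⊔ c′ ⊔ ℓ′)
A ≅ B = ∃ IsGroupIsomorphism
  where open GroupMorphisms (Group.rawGroup A) (Group.rawGroup B)

{-# OPTIONS --safe #-}

-- Write bᵢ = tᵢ = sᵢ₊₁ for the junction vertices and let Pᵢ = V(G₁) ∪ … ∪ V(Gᵢ).
-- The walks from s that stop as soon as they meet bᵢ reach exactly the vertices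
-- of Pᵢ, whereas any vertex other than s and the bᵢ is avoided by some walk from
-- s to t, because the parts are edges or parallel superedges.  Hence an oriented
-- automorphism permutes the bᵢ, and it preserves their order since bᵢ ∈ Pⱼ iff
-- i ≤ j.  So it fixes every bᵢ, preserves every Pᵢ, and therefore preserves every
-- V(Gᵢ).  Conversely, automorphisms of the parts agree on the junctions.
module Submission where

open import Defs
open import Algebra.Bundles using (Group)
open import Algebra.Morphism.Structures using (module GroupMorphisms)
open import Data.Fin.Base using (Fin; toℕ; fromℕ; inject₁) renaming (zero to 0F; suc to sucF)
open import Data.Fin.Induction using (<-weakInduction)
open import Data.Fin.Properties
  using (toℕ-injective; toℕ-fromℕ; toℕ-inject₁; toℕ<n; any?; _≟_)
open import Data.Fin.Subset using (_∈_; _∪_; ⁅_⁆)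
open import Data.Fin.Subset.Properties
  using (_∈?_; ∉⊥; x∈⁅y⁆⇒x≡y; x∈p∩q⁺; x∈p∪q⁻)
open import Data.Nat.Base using (ℕ; suc; z≤n; s≤s; _≤_; _<_; ∣_-_∣)
import Data.Nat.Properties as ℕ
open import Data.Product.Base using (∃-syntax; _×_; _,_; proj₁; proj₂)
open import Data.Sum.Base using (_⊎_; inj₁; inj₂; [_,_]′)
open import Data.Vec.Properties.WithK using ([]=-irrelevant)
open import Function.Base using (_∘_)
open import Function.Bundles using (Equivalence; mk⇔; mk↔ₛ′)
open import Relation.Binary.Definitions using (tri<; tri≈; tri>)
open import Relation.Binary.PropositionalEquality
open import Relation.Nullary using (¬_; yes; no; contradiction)

open OrientedGraph
open OrientedAutomorphism using (to; from; strictlyInverseˡ; strictlyInverseʳ;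
  preserves-adj; fixes-source; fixes-target)

private
  variable
    n k : ℕ
    G H : OrientedGraph n
    u v w x y : Fin n

-- Phrased by equations on `toℕ`, so that the two cases supply exactly the premises of the fields
-- `first` and `link`.
Fin-induction : (P : Fin k → Set) →
  (∀ i → toℕ i ≡ 0 → P i) →
  (∀ i j → toℕ j ≡ suc (toℕ i) → P i → P j) →
  ∀ i → P i
Fin-induction {k = suc _} P base step =
  <-weakInduction P (base 0F refl) (λ i → step (inject₁ i) (sucF i) (cong suc (sym (toℕ-inject₁ i))))

first-of : 2 ≤ k → ∃[ i ] toℕ {k} i ≡ 0
first-of {suc _} _ = 0F , refl

last-of : 2 ≤ k → ∃[ i ] suc (toℕ {k} i) ≡ k
last-of {suc m} _ = fromℕ m , cong suc (toℕ-fromℕ m)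

Vertex-≡ : (H : OrientedGraph n) {a b : Vertex H} → proj₁ a ≡ proj₁ b → a ≡ b
Vertex-≡ H {_ , p} {_ , q} refl = cong (_ ,_) ([]=-irrelevant p q)

-- Reachable H x w: some walk from the source to w has no vertex x before its end.
data Reachable (H : OrientedGraph n) (x : Fin n) : Fin n → Set where
  start : Reachable H x (source H)
  step  : Reachable H x u → u ≢ x → Adj H u v → Reachable H x v

-- Appends a walk of `H` to a walk of `G` that ends at the source of `H`. The stopping vertex may
-- change from `y` to `x` because every vertex before the end of the appended walk lies in `H` and
-- differs from `y`.
extend : (∀ {u v} → Adj H u v → Adj G u v) →
         (∀ {u} → u ∈ vertices H → u ≢ y → u ≢ x) →
         Reachable G x (source H) → Reachable H y w → Reachable G x w
extend H⊆G avoid r start          = r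
extend {H = H} H⊆G avoid r (step q u≢y uv) =
  step (extend {H = H} H⊆G avoid r q) (avoid (adj-vertex H uv) u≢y) (H⊆G uv)

AllReachable : OrientedGraph n → Set
AllReachable H = ∀ {w} → w ∈ vertices H → Reachable H (target H) w

-- Action of an oriented automorphism on vertices and walks.

module _ {G : OrientedGraph n} where

  infixr 8 _⁻¹
  _⁻¹ : OrientedAutomorphism G → OrientedAutomorphism G
  _⁻¹ = Group._⁻¹ (Autₒᵣ G)

  module _ (φ : OrientedAutomorphism G) where

    to-cong : ∀ {a b : Vertex G} → proj₁ a ≡ proj₁ b → proj₁ (to φ a) ≡ proj₁ (to φ b)
    to-cong a≡b = cong (proj₁ ∘ to φ) (Vertex-≡ G a≡b)

    from-to : ∀ {a b : Vertex G} → proj₁ (to φ a) ≡ proj₁ b → proj₁ a ≡ proj₁ (from φ b)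
    from-to {a} φa≡b =
      cong proj₁ (trans (sym (strictlyInverseʳ φ a)) (cong (from φ) (Vertex-≡ G φa≡b)))

    to-injective : ∀ {a b : Vertex G} → proj₁ (to φ a) ≡ proj₁ (to φ b) → proj₁ a ≡ proj₁ b
    to-injective {b = b} φa≡φb = trans (from-to φa≡φb) (cong proj₁ (strictlyInverseʳ φ b))

    fixes-source′ : ∀ {a : Vertex G} → proj₁ a ≡ source G → proj₁ (to φ a) ≡ source G
    fixes-source′ a≡s = trans (to-cong a≡s) (cong proj₁ (fixes-source φ))

    fixes-target′ : ∀ {a : Vertex G} → proj₁ a ≡ target G → proj₁ (to φ a) ≡ target G
    fixes-target′ a≡t = trans (to-cong a≡t) (cong proj₁ (fixes-target φ))

    preserves-Reachable : ∀ (a b : Vertex G) → Reachable G (proj₁ a) (proj₁ b) →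
                          Reachable G (proj₁ (to φ a)) (proj₁ (to φ b))
    preserves-Reachable a b start =
      subst (Reachable G _) (sym (fixes-source′ {b} refl)) start
    preserves-Reachable a b (step {u} r u≢a ub) =
      step (preserves-Reachable a u′ r) (u≢a ∘ to-injective)
           (Equivalence.to (preserves-adj φ u′ b) ub)
      where u′ = u , adj-vertex G ub

automorphism : (f g : Vertex H → Vertex H) →
  (∀ a → proj₁ (f (g a)) ≡ proj₁ a) → (∀ a → proj₁ (g (f a)) ≡ proj₁ a) →
  (∀ a b → Adj H (proj₁ a) (proj₁ b) → Adj H (proj₁ (f a)) (proj₁ (f b))) →
  (∀ a b → Adj H (proj₁ a) (proj₁ b) → Adj H (proj₁ (g a)) (proj₁ (g b))) →
  proj₁ (f (sourceVertex H)) ≡ source H → proj₁ (f (targetVertex H)) ≡ target H →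
  OrientedAutomorphism H
automorphism {H = H} f g fg gf f-adj g-adj f-source f-target = record
  { bijection     = mk↔ₛ′ f g (Vertex-≡ H ∘ fg) (Vertex-≡ H ∘ gf)
  ; preserves-adj = λ a b → mk⇔ (f-adj a b)
      (subst₂ (Adj H) (gf a) (gf b) ∘ g-adj (f a) (f b))
  ; fixes-source  = Vertex-≡ H f-source
  ; fixes-target  = Vertex-≡ H f-target
  }

-- Parts and junctions of a serial composition.

module Serial {n k} {G : OrientedGraph n} {Gs : Fin k → OrientedGraph n}
              (comp : IsSerialComposition G Gs)
              (parts-reachable : ∀ i → AllReachable (Gs i)) where

  open IsSerialComposition comp
  open IsUnion isUnion

  s t : Fin k → Fin n
  s i = source (Gs i)
  t i = target (Gs i)

  V : Fin k → Fin n → Set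
  V i v = v ∈ vertices (Gs i)

  P : Fin k → Fin n → Set
  P i v = ∃[ j ] toℕ j ≤ toℕ i × V j v

  s∈ : ∀ i → V i (s i)
  s∈ i = source∈ (Gs i)

  t∈ : ∀ i → V i (t i)
  t∈ i = target∈ (Gs i)

  s≢t : ∀ i → s i ≢ t i
  s≢t i = source≢target (Gs i)

  part⊆ : ∀ i {v} → V i v → v ∈ vertices G
  part⊆ i p = Equivalence.from (vertices-⋃ _) (i , p)

  part-of : v ∈ vertices G → ∃[ i ] V i v
  part-of = Equivalence.to (vertices-⋃ _)

  part-Adj : ∀ i {u v} → Adj (Gs i) u v → Adj G u v
  part-Adj i uv = Equivalence.from (edges-⋃ _ _) (i , uv)

  tᵥ : Fin k → Vertex G
  tᵥ i = t i , part⊆ i (t∈ i)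

  shared : ∀ {i j v} → toℕ i < toℕ j → V i v → V j v →
           toℕ j ≡ suc (toℕ i) × v ≡ s j
  shared {i} {j} i<j v∈i v∈j with toℕ j ℕ.≟ suc (toℕ i)
  ... | yes j≡1+i = j≡1+i , x∈⁅y⁆⇒x≡y _ (subst (_ ∈_) (meet i j j≡1+i) (x∈p∩q⁺ (v∈i , v∈j)))
  ... | no  j≢1+i = contradiction (subst (_ ∈_) (far i j 2≤j-i) (x∈p∩q⁺ (v∈i , v∈j))) ∉⊥
    where
    2≤j-i : 2 ≤ ∣ toℕ i - toℕ j ∣
    2≤j-i = subst (2 ≤_) (sym (ℕ.m≤n⇒∣m-n∣≡n∸m (ℕ.<⇒≤ i<j)))
      (ℕ.m+n≤o⇒m≤o∸n 2 (ℕ.≤∧≢⇒< i<j (j≢1+i ∘ sym)))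

  -- An earlier part can meet part `i` only in `s i`, which differs from `t i`.
  t∉earlier : ∀ {i j} → toℕ j < toℕ i → ¬ V j (t i)
  t∉earlier {i} j<i t∈j = s≢t i (sym (proj₂ (shared j<i t∈j (t∈ i))))

  t∈P⇒≤ : ∀ {i j} → P j (t i) → toℕ i ≤ toℕ j
  t∈P⇒≤ {i} (l , l≤j , t∈l) = ℕ.≮⇒≥ λ j<i → t∉earlier {i} (ℕ.≤-<-trans l≤j j<i) t∈l

  t-injective : ∀ {i j} → t i ≡ t j → i ≡ j
  t-injective {i} {j} ti≡tj = toℕ-injective (ℕ.≤-antisym
    (t∈P⇒≤ (j , ℕ.≤-refl , subst (V j) (sym ti≡tj) (t∈ j)))
    (t∈P⇒≤ (i , ℕ.≤-refl , subst (V i) ti≡tj (t∈ i))))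

  source-first-or-link : ∀ i → s i ≡ source G ⊎ ∃[ j ] s i ≡ t j
  source-first-or-link = Fin-induction _
    (λ i i≡0 → inj₁ (first i i≡0))
    (λ i j j≡1+i _ → inj₂ (i , sym (link i j j≡1+i)))

  -- Walks stopped at a junction.

  last-index : Fin k
  last-index = proj₁ (last-of 2≤k)

  t-last : t last-index ≡ target G
  t-last = last last-index (proj₂ (last-of 2≤k))

  ≤-last : ∀ i → toℕ i ≤ toℕ last-index
  ≤-last i = ℕ.≤-pred (subst (toℕ i <_) (sym (proj₂ (last-of 2≤k))) (toℕ<n i))

  -- The parts before `i` are crossed one at a time, each crossing ending at the source of the next
  -- part.
  s-chain : ∀ i → (∀ j → toℕ j < toℕ i → Reachable G x (s j) → Reachable G x (t j)) →
            Reachable G x (s i)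
  s-chain {x} = Fin-induction _
    (λ i i≡0 _ → subst (Reachable G x) (sym (first i i≡0)) start)
    (λ i j j≡1+i ih f → subst (Reachable G x) (link i j j≡1+i)
      (f i (ℕ.≤-reflexive (sym j≡1+i))
        (ih λ l l<i → f l (ℕ.<-trans l<i (ℕ.≤-reflexive (sym j≡1+i))))))

  avoids-t : ∀ {i j} → toℕ j ≤ toℕ i → V j u → u ≢ t j → u ≢ t i
  avoids-t {i = i} {j} j≤i u∈j u≢tj refl with ℕ.m≤n⇒m<n∨m≡n j≤i
  ... | inj₁ j<i = t∉earlier {i} j<i u∈j
  ... | inj₂ j≡i = u≢tj (cong t (toℕ-injective (sym j≡i)))

  -- Cross the parts before `j`, then walk inside part `j`. Within a part of index at most `i`, a
  -- walk that stops at the target of the part cannot meet `t i` before its end.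
  P⇒Reachable : ∀ {i} → P i w → Reachable G (t i) w
  P⇒Reachable {i = i} (j , j≤i , w∈j) =
    through j j≤i w∈j (s-chain j λ l l<j → through l (ℕ.≤-trans (ℕ.<⇒≤ l<j) j≤i) (t∈ l))
    where
    through : ∀ j → toℕ j ≤ toℕ i → V j v → Reachable G (t i) (s j) → Reachable G (t i) v
    through j j≤i v∈j r =
      extend {H = Gs j} (part-Adj j) (avoids-t {i = i} j≤i) r (parts-reachable j v∈j)

  -- An edge from `P i` into a part after `i` starts at a vertex shared by the two sides. That
  -- vertex is `t i`, where the walk would have stopped.
  Reachable⇒P : ∀ {i} → Reachable G (t i) w → P i w
  Reachable⇒P start with j , j≡0 ← first-of 2≤k =
    j , subst (_≤ _) (sym j≡0) z≤n , subst (V j) (first j j≡0) (s∈ j)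
  Reachable⇒P {i = i} (step r u≢ti uv) with Reachable⇒P r | Equivalence.to (edges-⋃ _ _) uv
  ... | j , j≤i , u∈j | l , uv′ with toℕ l ℕ.≤? toℕ i
  ...   | yes l≤i = l , l≤i , adj-vertex (Gs l) (adj-sym (Gs l) uv′)
  ...   | no  l≰i = contradiction u≡ti u≢ti
    where
    i<l   = ℕ.≰⇒> l≰i
    meets = shared (ℕ.≤-<-trans j≤i i<l) u∈j (adj-vertex (Gs l) uv′)
    i≤j   = ℕ.≤-pred (ℕ.≤-trans i<l (ℕ.≤-reflexive (proj₁ meets)))
    l≡1+i = trans (proj₁ meets) (cong suc (ℕ.≤-antisym j≤i i≤j))
    u≡ti  = trans (proj₂ meets) (sym (link i l l≡1+i))

  allReachable : AllReachable G
  allReachable w∈G with j , w∈j ← part-of w∈G =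
    subst (λ x → Reachable G x _) t-last (P⇒Reachable (j , ≤-last j , w∈j))

  -- If the edge came from another part, both of its ends would be the single vertex common to the
  -- two parts, making it a loop.
  Adj-within : ∀ i {u v} → V i u → V i v → Adj G u v → Adj (Gs i) u v
  Adj-within i {u} {v} u∈i v∈i uv with Equivalence.to (edges-⋃ _ _) uv
  ... | j , uv′ with ℕ.<-cmp (toℕ i) (toℕ j)
  ...   | tri≈ _ i≡j _ = subst (λ l → Adj (Gs l) u v) (toℕ-injective (sym i≡j)) uv′
  ...   | tri< i<j _ _ = contradiction uv (subst (λ w → ¬ Adj G u w) u≡v (adj-irrefl G))
    where
    u≡v = trans (proj₂ (shared i<j u∈i (adj-vertex (Gs j) uv′)))
            (sym (proj₂ (shared i<j v∈i (adj-vertex (Gs j) (adj-sym (Gs j) uv′)))))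
  ...   | tri> _ _ j<i = contradiction uv (subst (λ w → ¬ Adj G u w) u≡v (adj-irrefl G))
    where
    u≡v = trans (proj₂ (shared j<i (adj-vertex (Gs j) uv′) u∈i))
            (sym (proj₂ (shared j<i (adj-vertex (Gs j) (adj-sym (Gs j) uv′)) v∈i)))

  -- Gluing automorphisms of the parts.

  include : ∀ i → Vertex (Gs i) → Vertex G
  include i (v , v∈i) = v , part⊆ i v∈i

  PartAutomorphisms : Set
  PartAutomorphisms = ∀ i → OrientedAutomorphism (Gs i)

  -- A junction lies in two parts and `part-of` selects one of them; `consistent` makes the value
  -- independent of that choice.
  glue-to : PartAutomorphisms → Vertex G → Vertex G
  glue-to φs (v , v∈G) with i , v∈i ← part-of v∈G = include i (to (φs i) (v , v∈i))

  consistent-< : ∀ (φs : PartAutomorphisms) {i j} → toℕ i < toℕ j → (p : V i v) (q : V j v) →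
    proj₁ (to (φs i) (v , p)) ≡ proj₁ (to (φs j) (v , q))
  consistent-< {v} φs {i} {j} i<j p q with j≡1+i , v≡sj ← shared i<j p q = begin
    proj₁ (to (φs i) (v , p)) ≡⟨ fixes-target′ (φs i) (trans v≡sj (sym ti≡sj)) ⟩
    t i                       ≡⟨ ti≡sj ⟩
    s j                       ≡⟨ fixes-source′ (φs j) v≡sj ⟨
    proj₁ (to (φs j) (v , q)) ∎
    where
    open ≡-Reasoning
    ti≡sj = link i j j≡1+i

  consistent : ∀ (φs : PartAutomorphisms) i j (p : V i v) (q : V j v) →
    proj₁ (to (φs i) (v , p)) ≡ proj₁ (to (φs j) (v , q))
  consistent φs i j p q with ℕ.<-cmp (toℕ i) (toℕ j)
  ... | tri< i<j _ _ = consistent-< φs i<j p q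
  ... | tri> _ _ j<i = sym (consistent-< φs j<i q p)
  ... | tri≈ _ i≡j _ with refl ← toℕ-injective i≡j = to-cong (φs i) refl

  glue-on : ∀ (φs : PartAutomorphisms) i (a : Vertex G) (p : V i (proj₁ a)) →
    proj₁ (glue-to φs a) ≡ proj₁ (to (φs i) (proj₁ a , p))
  glue-on φs i a p = consistent φs _ i _ p

  glue-inverse : ∀ (φs ψs : PartAutomorphisms) → (∀ i a → to (φs i) (to (ψs i) a) ≡ a) →
    ∀ a → proj₁ (glue-to φs (glue-to ψs a)) ≡ proj₁ a
  glue-inverse φs ψs φψ (v , v∈G) with i , v∈i ← part-of v∈G =
    -- The inner image stays in part `i`, so the outer map may be evaluated there, whichever part
    -- `part-of` selects for it.
    trans (glue-on φs i (include i (to (ψs i) (v , v∈i))) (proj₂ (to (ψs i) (v , v∈i))))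
          (cong proj₁ (φψ i (v , v∈i)))

  glue-adj : ∀ (φs : PartAutomorphisms) a b → Adj G (proj₁ a) (proj₁ b) →
    Adj G (proj₁ (glue-to φs a)) (proj₁ (glue-to φs b))
  glue-adj φs a b ab with i , ab′ ← Equivalence.to (edges-⋃ _ _) ab =
    subst₂ (Adj G) (sym (glue-on φs i a a∈i)) (sym (glue-on φs i b b∈i))
      (part-Adj i (Equivalence.to (preserves-adj (φs i) (_ , a∈i) (_ , b∈i)) ab′))
    where
    a∈i = adj-vertex (Gs i) ab′
    b∈i = adj-vertex (Gs i) (adj-sym (Gs i) ab′)

  glue : PartAutomorphisms → OrientedAutomorphism G
  glue φs = automorphism (glue-to φs) (glue-to φs⁻¹)
    (glue-inverse φs φs⁻¹ (λ i → strictlyInverseˡ (φs i)))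
    (glue-inverse φs⁻¹ φs (λ i → strictlyInverseʳ (φs i)))
    (glue-adj φs) (glue-adj φs⁻¹)
    glue-source glue-target
    where
    φs⁻¹ = Group._⁻¹ (∏ (λ i → Autₒᵣ (Gs i))) φs

    glue-source : proj₁ (glue-to φs (sourceVertex G)) ≡ source G
    glue-source with f , f≡0 ← first-of 2≤k =
      trans (glue-on φs f (sourceVertex G) (subst (V f) (first f f≡0) (s∈ f)))
        (trans (fixes-source′ (φs f) (sym (first f f≡0))) (first f f≡0))

    glue-target : proj₁ (glue-to φs (targetVertex G)) ≡ target G
    glue-target =
      trans (glue-on φs last-index (targetVertex G) (subst (V last-index) t-last (t∈ _)))
        (trans (fixes-target′ (φs last-index) (sym t-last)) t-last)

  -- Rigidity of the junctions.

  module _ (detour : ∀ i {x} → x ≢ s i → x ≢ t i → Reachable (Gs i) x (t i)) where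

    -- Every end of a part is `source G` or some `t i`, so `x` is an end of no part and `detour`
    -- crosses each part around it.
    non-junction : x ≢ source G → (∀ i → x ≢ t i) → Reachable G x (target G)
    non-junction {x} x≢source x≢t =
      subst (Reachable G x) t-last
        (cross last-index (s-chain last-index λ j _ → cross j))
      where
      x≢s : ∀ i → x ≢ s i
      x≢s i x≡s with source-first-or-link i
      ... | inj₁ s≡source       = x≢source (trans x≡s s≡source)
      ... | inj₂ (j , s≡tj) = x≢t j (trans x≡s s≡tj)

      cross : ∀ i → Reachable G x (s i) → Reachable G x (t i)
      cross i r = extend {H = Gs i} (part-Adj i) (λ _ u≢x → u≢x) r
                    (detour i (x≢s i) (x≢t i))

    -- Otherwise `t i` would lie in the first part, which forces `i` to be the first index; but the
    -- two ends of the first part differ.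
    t≢source : ∀ i → t i ≢ source G
    t≢source i ti≡source with f , f≡0 ← first-of 2≤k =
      s≢t f (trans s≡ti (cong t (toℕ-injective (trans i≡0 (sym f≡0)))))
      where
      s≡ti = trans (first f f≡0) (sym ti≡source)
      i≡0  = ℕ.n≤0⇒n≡0 (ℕ.≤-trans (t∈P⇒≤ (f , ℕ.≤-refl , subst (V f) s≡ti (s∈ f)))
                                   (ℕ.≤-reflexive f≡0))

    module _ (φ : OrientedAutomorphism G) where

      -- If the image were no junction, some walk would reach `target G` around it. Its preimage
      -- reaches `target G` without meeting `t i` before the end, so `i` is the last index. But the
      -- last junction is `target G`, which `φ` fixes.
      permutes-t : ∀ i → ∃[ m ] proj₁ (to φ (tᵥ i)) ≡ t m
      permutes-t i with any? (λ m → proj₁ (to φ (tᵥ i)) ≟ t m)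
      ... | yes φt≡t = φt≡t
      ... | no  φt≢t = contradiction (last-index , φt≡t-last) φt≢t
        where
        φt≢source : proj₁ (to φ (tᵥ i)) ≢ source G
        φt≢source φt≡s = t≢source i (trans (from-to φ {b = sourceVertex G} φt≡s)
                           (fixes-source′ (φ ⁻¹) {sourceVertex G} refl))

        t-reachable : Reachable G (t i) (target G)
        t-reachable = subst₂ (Reachable G)
          (cong proj₁ (strictlyInverseʳ φ (tᵥ i)))
          (fixes-target′ (φ ⁻¹) {targetVertex G} refl)
          (preserves-Reachable (φ ⁻¹) (to φ (tᵥ i)) (targetVertex G)
            (non-junction φt≢source (λ m φt≡t → φt≢t (m , φt≡t))))

        i≡last : i ≡ last-index
        i≡last = toℕ-injective (ℕ.≤-antisym (≤-last i)
          (t∈P⇒≤ (Reachable⇒P (subst (Reachable G (t i)) (sym t-last) t-reachable))))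

        φt≡t-last : proj₁ (to φ (tᵥ i)) ≡ t last-index
        φt≡t-last = trans (fixes-target′ φ (trans (cong t i≡last) t-last)) (sym t-last)

      -- The induced map on indices is strictly increasing: weakly because `φ` preserves
      -- reachability, strictly because it is injective. A strictly increasing map on an initial
      -- segment of the naturals never falls below the identity.
      permutation-expands : ∀ i m → proj₁ (to φ (tᵥ i)) ≡ t m → toℕ i ≤ toℕ m
      permutation-expands = Fin-induction _ (λ i i≡0 _ _ → subst (_≤ _) (sym i≡0) z≤n) expand
        where
        expand : ∀ i j → toℕ j ≡ suc (toℕ i) →
                 (∀ m → proj₁ (to φ (tᵥ i)) ≡ t m → toℕ i ≤ toℕ m) →
                 ∀ m → proj₁ (to φ (tᵥ j)) ≡ t m → toℕ j ≤ toℕ m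
        expand i j j≡1+i ih m φtj≡tm with m′ , φti≡tm′ ← permutes-t i =
          subst (_≤ toℕ m) (sym j≡1+i) (ℕ.≤-<-trans (ih m′ φti≡tm′) (ℕ.≤∧≢⇒< m′≤m m′≢m))
          where
          i<j : toℕ i < toℕ j
          i<j = ℕ.≤-reflexive (sym j≡1+i)

          m′≤m : toℕ m′ ≤ toℕ m
          m′≤m = t∈P⇒≤ (Reachable⇒P (subst₂ (Reachable G) φtj≡tm φti≡tm′
            (preserves-Reachable φ (tᵥ j) (tᵥ i) (P⇒Reachable (i , ℕ.<⇒≤ i<j , t∈ i)))))

          m′≢m : toℕ m′ ≢ toℕ m
          m′≢m m′≡m = ℕ.<⇒≢ i<j (cong toℕ (t-injective (to-injective φ
            (trans φti≡tm′ (trans (cong t (toℕ-injective m′≡m)) (sym φtj≡tm))))))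

    -- The index map of `φ` and that of its inverse both lie above the identity, so each is the
    -- identity.
    fixes-t : ∀ φ i → proj₁ (to φ (tᵥ i)) ≡ t i
    fixes-t φ i with m , φti≡tm ← permutes-t φ i =
      trans φti≡tm (cong t (toℕ-injective (ℕ.≤-antisym
        (permutation-expands (φ ⁻¹) m i (sym (from-to φ {b = tᵥ m} φti≡tm)))
        (permutation-expands φ i m φti≡tm))))

    preserves-P : ∀ φ i (a : Vertex G) → P i (proj₁ a) → P i (proj₁ (to φ a))
    preserves-P φ i a a∈P = Reachable⇒P
      (subst (λ x → Reachable G x _) (fixes-t φ i)
        (preserves-Reachable φ (tᵥ i) a (P⇒Reachable a∈P)))

    fixes-s : ∀ φ i {a : Vertex G} → proj₁ a ≡ s i → proj₁ (to φ a) ≡ s i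
    fixes-s φ i a≡s with source-first-or-link i
    ... | inj₁ s≡source       = trans (fixes-source′ φ (trans a≡s s≡source)) (sym s≡source)
    ... | inj₂ (j , s≡tj) =
      trans (to-cong φ {b = tᵥ j} (trans a≡s s≡tj)) (trans (fixes-t φ j) (sym s≡tj))

    -- If φ sends a vertex of Vᵢ into Vⱼ with j < i, then applying φ⁻¹ shows that the
    -- vertex lies in Pⱼ ∩ Vᵢ ⊆ {sᵢ}, and sᵢ is fixed.
    preserves-V : ∀ φ i (a : Vertex G) → V i (proj₁ a) → V i (proj₁ (to φ a))
    preserves-V φ i a a∈i with preserves-P φ i a (i , ℕ.≤-refl , a∈i)
    ... | j , j≤i , φa∈j with ℕ.m≤n⇒m<n∨m≡n j≤i
    ...   | inj₂ j≡i = subst (λ l → V l _) (toℕ-injective j≡i) φa∈j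
    ...   | inj₁ j<i
      with l , l≤j , a∈l ← preserves-P (φ ⁻¹) j (to φ a) (j , ℕ.≤-refl , φa∈j) =
      subst (V i) (sym (fixes-s φ i a≡s)) (s∈ i)
      where
      a≡s : proj₁ a ≡ s i
      a≡s = proj₂ (shared (ℕ.≤-<-trans l≤j j<i)
              (subst (V l) (cong proj₁ (strictlyInverseʳ φ a)) a∈l) a∈i)

    -- Restriction to the parts and the isomorphism.

    restrict : OrientedAutomorphism G → ∀ i → OrientedAutomorphism (Gs i)
    restrict φ i = automorphism (restrict-to φ) (restrict-to (φ ⁻¹))
      (λ a → trans (to-cong φ refl) (cong proj₁ (strictlyInverseˡ φ (include i a))))
      (λ a → trans (to-cong (φ ⁻¹) refl) (cong proj₁ (strictlyInverseʳ φ (include i a))))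
      (restrict-adj φ) (restrict-adj (φ ⁻¹))
      (fixes-s φ i refl) (fixes-t φ i)
      where
      restrict-to : OrientedAutomorphism G → Vertex (Gs i) → Vertex (Gs i)
      restrict-to ψ a = proj₁ (to ψ (include i a)) , preserves-V ψ i (include i a) (proj₂ a)

      restrict-adj : ∀ ψ a b → Adj (Gs i) (proj₁ a) (proj₁ b) →
        Adj (Gs i) (proj₁ (restrict-to ψ a)) (proj₁ (restrict-to ψ b))
      restrict-adj ψ a b ab = Adj-within i (proj₂ (restrict-to ψ a)) (proj₂ (restrict-to ψ b))
        (Equivalence.to (preserves-adj ψ (include i a) (include i b)) (part-Adj i ab))

    Aut≅∏ : Autₒᵣ G ≅ ∏ (λ i → Autₒᵣ (Gs i))
    Aut≅∏ = restrict , record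
      { isGroupMonomorphism = record
        { isGroupHomomorphism = record
          { isMonoidHomomorphism = record
            { isMagmaHomomorphism = record
              { isRelHomomorphism = record
                { cong = λ φ≈ψ i a → Vertex-≡ (Gs i) (cong proj₁ (φ≈ψ (include i a))) }
              -- The two composites differ only in the membership proof carried by the intermediate
              -- vertex.
              ; homo = λ φ ψ i a → Vertex-≡ (Gs i) (to-cong φ refl)
              }
            ; ε-homo = λ i a → Vertex-≡ (Gs i) refl
            }
          ; ⁻¹-homo = λ φ i a → Vertex-≡ (Gs i) refl
          }
        ; injective = restrict-injective
        }
      ; surjective = λ φs → glue φs , λ {ψ} ψ≈glue i a → Vertex-≡ (Gs i)
          (trans (cong proj₁ (ψ≈glue (include i a))) (glue-on φs i (include i a) (proj₂ a)))
      }
      where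
      restrict-injective : ∀ {φ ψ} → (∀ i a → to (restrict φ i) a ≡ to (restrict ψ i) a) →
                           ∀ a → to φ a ≡ to ψ a
      restrict-injective {φ} {ψ} eq (v , v∈G) with i , v∈i ← part-of v∈G =
        Vertex-≡ G (trans (to-cong φ refl)
          (trans (cong proj₁ (eq i (v , v∈i))) (to-cong ψ refl)))

-- Walks in series-parallel graphs.

seriesParallel⇒AllReachable : IsSeriesParallel H → AllReachable H
seriesParallel⇒AllReachable {H = H} (edge isEdge) {w} w∈H
  with x∈p∪q⁻ ⁅ source H ⁆ ⁅ target H ⁆ (subst (w ∈_) (IsSingleEdge.vertices-≡ isEdge) w∈H)
... | inj₁ w∈s rewrite x∈⁅y⁆⇒x≡y _ w∈s = start
... | inj₂ w∈t rewrite x∈⁅y⁆⇒x≡y _ w∈t =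
  step start (source≢target H) (IsSingleEdge.adjacent isEdge)
-- The induction hypothesis is precisely the reachability parameter of `Serial`.
seriesParallel⇒AllReachable (serial comp parts) =
  Serial.allReachable comp (λ i → seriesParallel⇒AllReachable (parts i))
-- Each part shares both ends with `H`, so its walks keep their starting point and their stopping
-- vertex.
seriesParallel⇒AllReachable {H = H} (parallel {Gs = Gs} comp parts) w∈H
  with i , w∈i ← Equivalence.to (IsUnion.vertices-⋃ (IsParallelComposition.isUnion comp) _) w∈H =
  extend {H = Gs i} (λ uv → Equivalence.from (IsUnion.edges-⋃ isUnion _ _) (i , uv))
    (λ _ → subst (_ ≢_) (targets i))
    (subst (Reachable H _) (sym (sources i)) start)
    (seriesParallel⇒AllReachable (parts i) w∈i)
  where open IsParallelComposition comp

-- A vertex other than the ends lies in at most one of two parallel parts.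
nonSerial⇒detour : IsSeriesParallel H → NonSerial H →
                   x ≢ source H → x ≢ target H → Reachable H x (target H)
nonSerial⇒detour (edge isEdge) _ x≢s _ = step start (x≢s ∘ sym) (IsSingleEdge.adjacent isEdge)
nonSerial⇒detour (serial comp parts) nonSerial _ _ =
  contradiction (_ , _ , comp , parts) nonSerial
nonSerial⇒detour {H = H} {x} (parallel {k} {Gs = Gs} comp parts) _ x≢s x≢t =
  choose 2≤k
  where
  open IsParallelComposition comp

  via : ∀ i → ¬ x ∈ vertices (Gs i) → Reachable H x (target H)
  via i x∉i = subst (Reachable H x) (targets i)
    (extend {H = Gs i} (λ uv → Equivalence.from (IsUnion.edges-⋃ isUnion _ _) (i , uv))
      (λ u∈i _ u≡x → x∉i (subst (_∈ vertices (Gs i)) u≡x u∈i))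
      (subst (Reachable H x) (sym (sources i)) start)
      (seriesParallel⇒AllReachable (parts i) (target∈ (Gs i))))

  either : ∀ i j → i ≢ j → Reachable H x (target H)
  either i j i≢j with x ∈? vertices (Gs i)
  ... | no  x∉i = via i x∉i
  ... | yes x∈i = via j λ x∈j →
    [ x≢s ∘ x∈⁅y⁆⇒x≡y _ , x≢t ∘ x∈⁅y⁆⇒x≡y _ ]′
      (x∈p∪q⁻ ⁅ source H ⁆ ⁅ target H ⁆ (subst (x ∈_) (meet i j i≢j) (x∈p∩q⁺ (x∈i , x∈j))))

  choose : 2 ≤ k → Reachable H x (target H)
  choose (s≤s (s≤s _)) = either 0F (sucF 0F) λ ()

theorem5p3 : ∀ {n k : ℕ} (G : OrientedGraph n) (Gs : Fin k → OrientedGraph n) →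
    IsSerialSuperedge G Gs →
    (∀ i → NonSerial (Gs i)) →
    Autₒᵣ G ≅ ∏ (λ i → Autₒᵣ (Gs i))
theorem5p3 G Gs (comp , parts) nonSerial =
  Serial.Aut≅∏ comp (λ i → seriesParallel⇒AllReachable (parts i))
    (λ i → nonSerial⇒detour (parts i) (nonSerial i))
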